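{- Let $\mathcal{M}=(E,\mathcal{I})$ be a matroid, $w:E\to\mathbb{R}$ a weight function and $k\ge 1$ an integer. Then every maximum-weight basis of $\mathcal{M}$ is an optimal first-stage solution of the problem $$\max_{S\in\mathcal{I}}\ \min_{F\subseteq E,\,|F|\le k}\ \max_{\substack{R\subseteq E\setminus(S\cup F),\ |R|\le k\\ (S\cup R)\setminus F\in\mathcal{I}}} w\big((S\cup R)\setminus F\big).$$ Consequently, this problem ($(k,k)$-Robust Matroid Basis) is solvable in polynomial time.
   Context: The weight of a set is the sum of the weights of its elements. A first-stage solution is the set $S$ chosen in the outer maximization; it is optimal if it attains the outer maximum.
   Formalization: The first claim is proved for nonnegative weights, since it fails for negative ones (a single independent element of weight −1, k = 1: the basis has value −1, the empty set 0); the polynomial-time claim (finding an optimal S with an independence oracle) is proved for arbitrary weights. -}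

module Defs where

open import Algebra.Bundles using (AbelianGroup)
open import Algebra.Structures using (IsAbelianGroup)
import Algebra.Properties.CommutativeMonoid.Sum as Sum
open import Data.Bool using (Bool; true; false; if_then_else_)
open import Data.Fin using (Fin; fromℕ<)
open import Data.Fin.Subset using (Subset; _∈_; _∉_; _⊆_; _∪_; _─_; ∁; ⁅_⁆; ∣_∣) renaming (⊥ to ∅)
open import Data.Maybe using (Maybe; just; nothing; maybe′)
open import Data.Nat as ℕ using (ℕ; zero; suc)
open import Data.Nat.Properties using (_<?_)
open import Data.Product using (_×_; ∃; ∃-syntax)
open import Data.Vec using (lookup)
open import Level using (Level; 0ℓ; _⊔_) renaming (suc to lsuc)
open import Relation.Binary using (Rel; IsDecTotalOrder)
open import Relation.Binary.PropositionalEquality using (_≡_)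
open import Relation.Nullary using (yes; no; does)
open import Relation.Unary using (Pred; Decidable)

-- Linearly ordered abelian groups.  The real numbers (with classical logic,
-- which makes their order decidable) are an instance.
record OrderedAbelianGroup (c ℓ₁ ℓ₂ : Level) : Set (lsuc (c ⊔ ℓ₁ ⊔ ℓ₂)) where
  infix  4 _≈_ _≤_
  infixl 6 _+_
  field
    Carrier         : Set c
    _≈_             : Rel Carrier ℓ₁
    _≤_             : Rel Carrier ℓ₂
    _+_             : Carrier → Carrier → Carrier
    0#              : Carrier
    -_              : Carrier → Carrier
    isAbelianGroup  : IsAbelianGroup _≈_ _+_ 0# -_
    isDecTotalOrder : IsDecTotalOrder _≈_ _≤_
    +-mono-≤        : ∀ {x y u v} → x ≤ y → u ≤ v → (x + u) ≤ (y + v)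

  abelianGroup : AbelianGroup c ℓ₁
  abelianGroup = record { isAbelianGroup = isAbelianGroup }

  open AbelianGroup abelianGroup public using (commutativeMonoid)
  open IsDecTotalOrder isDecTotalOrder public using (_≤?_)

record Matroid (n : ℕ) : Set₁ where
  field
    Indep   : Pred (Subset n) 0ℓ
    indep?  : Decidable Indep
    ∅-indep : Indep ∅
    ⊆-indep : ∀ {A B} → A ⊆ B → Indep B → Indep A
    augment : ∀ {A B} → Indep A → Indep B → ∣ A ∣ ℕ.< ∣ B ∣ →
              ∃[ e ] (e ∈ B × e ∉ A × Indep (A ∪ ⁅ e ⁆))

  IsBasis : Pred (Subset n) 0ℓ
  IsBasis B = Indep B × (∀ {A} → Indep A → B ⊆ A → A ≡ B)

module _ {c ℓ₁ ℓ₂} (G : OrderedAbelianGroup c ℓ₁ ℓ₂) where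
  open OrderedAbelianGroup G
  open Sum commutativeMonoid using (sum)

  IsMaximum IsMinimum : ∀ {ℓ} → Pred Carrier ℓ → Pred Carrier (c ⊔ ℓ₂ ⊔ ℓ)
  IsMaximum V v = V v × (∀ {u} → V u → u ≤ v)
  IsMinimum V v = V v × (∀ {u} → V u → v ≤ u)

  module _ {n} (w : Fin n → Carrier) where

    weight : Subset n → Carrier
    weight A = sum (λ e → if lookup A e then w e else 0#)

    module _ (M : Matroid n) where
      open Matroid M

      IsMaxWeightBasis : Pred (Subset n) ℓ₂
      IsMaxWeightBasis B = IsBasis B × (∀ {A} → IsBasis A → weight A ≤ weight B)

      -- The three nested optima are rendered as "v is the maximum (minimum) of
      -- the set of objective values of the feasible choices".
      module Robust (k : ℕ) where

        Recovery : Subset n → Subset n → Pred (Subset n) 0ℓ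
        Recovery S F R = R ⊆ ∁ (S ∪ F) × ∣ R ∣ ℕ.≤ k × Indep ((S ∪ R) ─ F)

        RecoveryValue : Subset n → Subset n → Pred Carrier (c ⊔ ℓ₁ ⊔ ℓ₂)
        RecoveryValue S F =
          IsMaximum (λ v → ∃[ R ] (Recovery S F R × v ≈ weight ((S ∪ R) ─ F)))

        FirstStageValue : Subset n → Pred Carrier (c ⊔ ℓ₁ ⊔ ℓ₂)
        FirstStageValue S =
          IsMinimum (λ v → ∃[ F ] (∣ F ∣ ℕ.≤ k × RecoveryValue S F v))

        OptimalValue : Pred Carrier (c ⊔ ℓ₁ ⊔ ℓ₂)
        OptimalValue = IsMaximum (λ v → ∃[ S ] (Indep S × FirstStageValue S v))

        IsOptimalFirstStage : Pred (Subset n) (c ⊔ ℓ₁ ⊔ ℓ₂)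
        IsOptimalFirstStage S =
          Indep S × ∃[ v ] (FirstStageValue S v × OptimalValue v)

-- Algorithms are programs of a small imperative language with an independence
-- oracle.  A program refers to finitely many number registers and finitely many
-- set registers (bit arrays indexed by the ground set), both named by ℕ.
-- Numbers only grow by increments, and sets change by one element at a time, so
-- unit cost per step is polynomially related to Turing-machine time, relative
-- to the independence oracle and to comparisons of weights.

data Test : Set where
  _<ᵗ_    : (x y : ℕ) → Test
  _∈ᵗ_    : (x a : ℕ) → Test
  indepᵗ  : (a : ℕ) → Test
  _≤ʷ_    : (x y : ℕ) → Test
  0≤ʷ_    : (x : ℕ) → Test

infixr 5 _⨾_

data Program : Set where
  skip    : Program
  zeroᵖ   : (x : ℕ) → Program
  incᵖ    : (x : ℕ) → Program
  _≔_     : (x y : ℕ) → Program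
  insertᵖ : (x a : ℕ) → Program
  deleteᵖ : (x a : ℕ) → Program
  _⨾_     : (p q : Program) → Program
  ifᵖ     : (b : Test) (p q : Program) → Program
  whileᵖ  : (b : Test) (p : Program) → Program

_[_↦_] : ∀ {a} {A : Set a} → (ℕ → A) → ℕ → A → (ℕ → A)
(f [ x ↦ v ]) y = if x ℕ.≡ᵇ y then v else f y

record State (n : ℕ) : Set where
  constructor ⟨_,_⟩
  field
    num : ℕ → ℕ
    set : ℕ → Subset n
open State public

-- Numbers that are not below n denote no element: tests about them fail, and
-- insertions and deletions have no effect.
element : ∀ n → ℕ → Maybe (Fin n)
element n i with i <? n
... | yes i<n = just (fromℕ< i<n)
... | no  _   = nothing

-- Input: n in number register 0 and k in number register 1.
-- Output: set register 0 of the final state.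
initial : ∀ n → ℕ → State n
num (initial n k) 0 = n
num (initial n k) 1 = k
num (initial n k) (suc (suc _)) = 0
set (initial n k) _ = ∅

output : ∀ {n} → State n → Subset n
output s = set s 0

module _ {c ℓ₁ ℓ₂} (G : OrderedAbelianGroup c ℓ₁ ℓ₂) where
  open OrderedAbelianGroup G

  module Machine {n} (w : Fin n → Carrier) (M : Matroid n) where
    open Matroid M

    withElement : ∀ {a} {A : Set a} → A → State n → ℕ → (Fin n → A) → A
    withElement default s x f = maybe′ f default (element n (num s x))

    test : Test → State n → Bool
    test (x <ᵗ y)   s = does (num s x <? num s y)
    test (x ∈ᵗ a)   s = withElement false s x λ e → lookup (set s a) e
    test (indepᵗ a) s = does (indep? (set s a))
    test (x ≤ʷ y)   s = withElement false s x λ e →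
                        withElement false s y λ f → does (w e ≤? w f)
    test (0≤ʷ x)    s = withElement false s x λ e → does (0# ≤? w e)

    -- Run p s t s′: started in s, p halts in s′ after exactly t steps.
    data Run : Program → State n → ℕ → State n → Set where
      skip   : ∀ {s} → Run skip s 1 s
      zeroᵖ  : ∀ {x s} → Run (zeroᵖ x) s 1 ⟨ num s [ x ↦ 0 ] , set s ⟩
      incᵖ   : ∀ {x s} → Run (incᵖ x) s 1 ⟨ num s [ x ↦ suc (num s x) ] , set s ⟩
      assign : ∀ {x y s} → Run (x ≔ y) s 1 ⟨ num s [ x ↦ num s y ] , set s ⟩
      insertᵖ : ∀ {x a s} → Run (insertᵖ x a) s 1
        (withElement s s x λ e → ⟨ num s , set s [ a ↦ set s a ∪ ⁅ e ⁆ ] ⟩)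
      deleteᵖ : ∀ {x a s} → Run (deleteᵖ x a) s 1
        (withElement s s x λ e → ⟨ num s , set s [ a ↦ set s a ─ ⁅ e ⁆ ] ⟩)
      _⨾_ : ∀ {p q s s′ s″ t t′} →
        Run p s t s′ → Run q s′ t′ s″ → Run (p ⨾ q) s (t ℕ.+ t′) s″
      if-true : ∀ {b p q s s′ t} →
        test b s ≡ true → Run p s t s′ → Run (ifᵖ b p q) s (suc t) s′
      if-false : ∀ {b p q s s′ t} →
        test b s ≡ false → Run q s t s′ → Run (ifᵖ b p q) s (suc t) s′
      while-true : ∀ {b p s s′ s″ t t′} →
        test b s ≡ true → Run p s t s′ → Run (whileᵖ b p) s′ t′ s″ →
        Run (whileᵖ b p) s (suc (t ℕ.+ t′)) s″
      while-false : ∀ {b p s} →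
        test b s ≡ false → Run (whileᵖ b p) s 1 s

  -- One program, and one polynomial a (n + 1)ᵈ, serve all instances.
  RobustMatroidBasisInPolynomialTime : Set (lsuc 0ℓ ⊔ c ⊔ ℓ₁ ⊔ ℓ₂)
  RobustMatroidBasisInPolynomialTime =
    ∃[ p ] ∃[ a ] ∃[ d ]
      (∀ {n} (M : Matroid n) (w : Fin n → Carrier) (k : ℕ) → 1 ℕ.≤ k →
        ∃[ t ] ∃[ s ] (Machine.Run w M p (initial n k) t s
                       × t ℕ.≤ a ℕ.* suc n ℕ.^ d
                       × Robust.IsOptimalFirstStage G w M k (output s)))

{-# OPTIONS --safe #-}

-- Call an independent set optimal for F if it has maximum weight among those avoiding F.  After
-- the failure F, no first-stage solution can be repaired to more than the weight of such a set.
-- Conversely a maximum-weight independent set S reaches this weight for every F: elements fail one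
-- at a time, and by symmetric exchange each failure is repaired optimally by at most one insertion,
-- so S ─ F extends to an optimal set for F by at most ∣ F ∣ insertions.  Hence S is an optimal first
-- stage.  With nonnegative weights, maximum-weight bases are maximum-weight independent sets; with
-- arbitrary weights, the greedy algorithm restricted to elements of nonnegative weight finds one.
module Submission where

open import Algebra.Bundles using (AbelianGroup)
open import Data.Bool using (true; false)
open import Data.Empty using (⊥-elim)
open import Data.Fin using (Fin; zero; suc; toℕ; fromℕ<)
open import Data.Fin.Properties using (any?; _≟_; toℕ<n; fromℕ<-toℕ; toℕ-fromℕ<; toℕ-injective)
open import Data.Fin.Subset using (Subset; _∈_; _∉_; _⊆_; _⊈_; _∪_; _─_; _-_; ∁; ⁅_⁆; ∣_∣) renaming (⊥ to ∅)
open import Data.Fin.Subset.Properties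
open import Data.Maybe using (just; nothing; maybe′)
open import Data.Nat as ℕ using (ℕ; zero; suc)
import Data.Nat.Properties as ℕ
open import Data.Nat.Tactic.RingSolver using (solve-∀)
open import Data.Product using (_×_; _,_; ∃; ∃-syntax; proj₁; proj₂)
open import Data.Sum using (_⊎_; inj₁; inj₂; [_,_]′)
open import Data.Vec using (_∷_; []; lookup; tabulate; here; there)
open import Data.Vec.Properties using (lookup∘tabulate; lookup⇒[]=; []=⇒lookup)
open import Defs
open import Function using (_∘_; flip)
open import Relation.Binary using (Rel; IsDecTotalOrder; Total; Transitive; tri<; tri≈; tri>)
open import Relation.Binary.PropositionalEquality using (_≡_; _≢_; refl; sym; trans; cong; subst)
open import Relation.Nullary using (¬_; Dec; yes; no; does; ¬?; contradiction)
open import Relation.Nullary.Decidable using (_×-dec_; dec-true; dec-false; decidable-stable)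
open import Relation.Unary using (Pred; Decidable)

-- Subsets

∈-insert : ∀ {n} (p : Subset n) x → x ∈ p ∪ ⁅ x ⁆
∈-insert p x = q⊆p∪q p ⁅ x ⁆ (x∈⁅x⁆ x)

∈-insert⁻ : ∀ {n} (p : Subset n) {x y} → x ∈ p ∪ ⁅ y ⁆ → x ∈ p ⊎ x ≡ y
∈-insert⁻ p {y = y} x∈ with x∈p∪q⁻ p ⁅ y ⁆ x∈
... | inj₁ x∈p = inj₁ x∈p
... | inj₂ x∈y = inj₂ (x∈⁅y⁆⇒x≡y y x∈y)

∈-─⇒∉ : ∀ {n} (p q : Subset n) {x} → x ∈ p ─ q → x ∉ q
∈-─⇒∉ (true ∷ p) (false ∷ q) {zero} _ ()
∈-─⇒∉ (_ ∷ p) (false ∷ q) {suc x} x∈ = ∈-─⇒∉ p q (drop-there x∈) ∘ drop-there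
∈-─⇒∉ (_ ∷ p) (true ∷ q) {suc x} x∈ = ∈-─⇒∉ p q (drop-there x∈) ∘ drop-there

∈-delete⇒≢ : ∀ {n} (p : Subset n) {x y} → x ∈ p - y → x ≢ y
∈-delete⇒≢ p {y = y} x∈ = x∉⁅y⁆⇒x≢y (∈-─⇒∉ p ⁅ y ⁆ x∈)

insert-⊆ : ∀ {n} {p q : Subset n} {x} → p ⊆ q → x ∈ q → p ∪ ⁅ x ⁆ ⊆ q
insert-⊆ {p = p} p⊆q x∈q y∈ with ∈-insert⁻ p y∈
... | inj₁ y∈p = p⊆q y∈p
... | inj₂ refl = x∈q

insert-mono : ∀ {n} {p q : Subset n} {x} → p ⊆ q → p ∪ ⁅ x ⁆ ⊆ q ∪ ⁅ x ⁆
insert-mono {q = q} {x} p⊆q = insert-⊆ (p⊆p∪q ⁅ x ⁆ ∘ p⊆q) (∈-insert q x)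

insert-delete : ∀ {n} {p : Subset n} {x} → x ∈ p → (p - x) ∪ ⁅ x ⁆ ≡ p
insert-delete {p = p} {x} x∈p = ⊆-antisym (insert-⊆ (p─q⊆p p ⁅ x ⁆) x∈p) p⊆
  where
  p⊆ : p ⊆ (p - x) ∪ ⁅ x ⁆
  p⊆ {y} y∈p with y ≟ x
  ... | yes refl = ∈-insert (p - x) x
  ... | no  y≢x  = p⊆p∪q ⁅ x ⁆ (x∈p∧x≢y⇒x∈p-y y∈p y≢x)

delete-insert : ∀ {n} {p : Subset n} {x} → x ∉ p → (p ∪ ⁅ x ⁆) - x ≡ p
delete-insert {p = p} {x} x∉p = ⊆-antisym to from
  where
  to : (p ∪ ⁅ x ⁆) - x ⊆ p
  to y∈ with ∈-insert⁻ p (p─q⊆p (p ∪ ⁅ x ⁆) ⁅ x ⁆ y∈)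
  ... | inj₁ y∈p = y∈p
  ... | inj₂ y≡x = contradiction y≡x (∈-delete⇒≢ (p ∪ ⁅ x ⁆) y∈)
  from : p ⊆ (p ∪ ⁅ x ⁆) - x
  from y∈p = x∈p∧x≢y⇒x∈p-y (p⊆p∪q ⁅ x ⁆ y∈p) λ { refl → x∉p y∈p }

∣insert∣≤ : ∀ {n} (p : Subset n) x → ∣ p ∪ ⁅ x ⁆ ∣ ℕ.≤ suc ∣ p ∣
∣insert∣≤ (true  ∷ p) zero rewrite ∪-identityʳ p = ℕ.n≤1+n _
∣insert∣≤ (false ∷ p) zero rewrite ∪-identityʳ p = ℕ.≤-refl
∣insert∣≤ (true  ∷ p) (suc x) = ℕ.s≤s (∣insert∣≤ p x)
∣insert∣≤ (false ∷ p) (suc x) = ∣insert∣≤ p x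

∣p∣<∣insert∣ : ∀ {n} {p : Subset n} {x} → x ∉ p → ∣ p ∣ ℕ.< ∣ p ∪ ⁅ x ⁆ ∣
∣p∣<∣insert∣ {p = p} {x} x∉p = p⊂q⇒∣p∣<∣q∣ (p⊆p∪q ⁅ x ⁆ , x , ∈-insert p x , x∉p)

⊈-witness : ∀ {n} {p q : Subset n} → p ⊈ q → ∃[ x ] (x ∈ p × x ∉ q)
⊈-witness {p = p} {q} p⊈q with any? (λ x → (x ∈? p) ×-dec ¬? (x ∈? q))
... | yes found = found
... | no  none  = ⊥-elim (p⊈q λ {x} x∈p → decidable-stable (x ∈? q) λ x∉q → none (x , x∈p , x∉q))

module _ {n ℓ} {P : Pred (Fin n) ℓ} (P? : Decidable P) where

  comprehension : Subset n
  comprehension = tabulate (does ∘ P?)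

  ∈-comprehension⁺ : ∀ {x} → P x → x ∈ comprehension
  ∈-comprehension⁺ {x} px =
    lookup⇒[]= x comprehension (trans (lookup∘tabulate (does ∘ P?) x) (dec-true (P? x) px))

  ∈-comprehension⁻ : ∀ {x} → x ∈ comprehension → P x
  ∈-comprehension⁻ {x} x∈ = decidable-stable (P? x) λ ¬px →
    contradiction (trans (sym (trans (lookup∘tabulate (does ∘ P?) x) (dec-false (P? x) ¬px))) ([]=⇒lookup x∈)) λ ()

-- Optimisation over the subsets of a finite set.

module _ {a ℓ} {A : Set a} {_≼_ : Rel A ℓ} (total : Total _≼_) (≼-trans : Transitive _≼_) where

  ≼-refl : ∀ {x} → x ≼ x
  ≼-refl {x} = [ (λ p → p) , (λ p → p) ]′ (total x x)

  -- Subsets with and without the first element are optimised separately and the two winners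
  -- compared. The order is any total transitive relation, so flipping it gives minima.
  argmax? : ∀ {n p} {P : Pred (Subset n) p} → Decidable P → (f : Subset n → A) →
            (∀ X → ¬ P X) ⊎ ∃[ X ] (P X × (∀ {Y} → P Y → f Y ≼ f X))
  argmax? {zero} P? f with P? []
  ... | yes p = inj₂ ([] , p , λ { {[]} _ → ≼-refl })
  ... | no ¬p = inj₁ λ { [] → ¬p }
  argmax? {suc n} P? f with argmax? (P? ∘ (true ∷_)) (f ∘ (true ∷_)) | argmax? (P? ∘ (false ∷_)) (f ∘ (false ∷_))
  ... | inj₁ none | inj₁ none′ = inj₁ λ { (true ∷ X) → none X ; (false ∷ X) → none′ X }
  ... | inj₁ none | inj₂ (X , p , max) =
    inj₂ (false ∷ X , p , λ { {true ∷ Y} q → contradiction q (none Y) ; {false ∷ Y} q → max q })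
  ... | inj₂ (X , p , max) | inj₁ none =
    inj₂ (true ∷ X , p , λ { {false ∷ Y} q → contradiction q (none Y) ; {true ∷ Y} q → max q })
  ... | inj₂ (X , p , max) | inj₂ (X′ , p′ , max′) with total (f (true ∷ X)) (f (false ∷ X′))
  ...   | inj₁ le = inj₂ (false ∷ X′ , p′ , λ { {true ∷ Y} q → ≼-trans (max q) le ; {false ∷ Y} q → max′ q })
  ...   | inj₂ ge = inj₂ (true ∷ X , p , λ { {true ∷ Y} q → max q ; {false ∷ Y} q → ≼-trans (max′ q) ge })

  argmax : ∀ {n p} {P : Pred (Subset n) p} → Decidable P → (f : Subset n → A) → ∃ P →
           ∃[ X ] (P X × (∀ {Y} → P Y → f Y ≼ f X))
  argmax P? f (X , p) with argmax? P? f
  ... | inj₁ none = contradiction p (none X)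
  ... | inj₂ best = best

-- Exchange in matroids

module _ {n} (M : Matroid n) where
  open Matroid M

  -- Grow A by elements of T until it is as large as T; it then is T with some e traded for f.
  trade : ∀ {A T f} → Indep A → Indep T → f ∈ A → A ⊆ T ∪ ⁅ f ⁆ →
          Indep (T ∪ ⁅ f ⁆) ⊎ ∃[ e ] (e ∈ T × e ∉ A × Indep ((T - e) ∪ ⁅ f ⁆))
  trade {T = T} {f} iA iT = grow ∣ T ∣ (ℕ.m≤m+n _ _) iA
    where
    -- `m` bounds the deficit of `A` in size against `T`, which every augmentation lowers.
    grow : ∀ m {A} → ∣ T ∣ ℕ.≤ m ℕ.+ ∣ A ∣ → Indep A → f ∈ A → A ⊆ T ∪ ⁅ f ⁆ →
           Indep (T ∪ ⁅ f ⁆) ⊎ ∃[ e ] (e ∈ T × e ∉ A × Indep ((T - e) ∪ ⁅ f ⁆))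
    grow m {A} T≤ iA f∈A A⊆ with ℕ.<-cmp ∣ A ∣ ∣ T ∣
    grow zero T≤ iA f∈A A⊆ | tri< A<T _ _ = contradiction T≤ (ℕ.<⇒≱ A<T)
    grow (suc m) {A} T≤ iA f∈A A⊆ | tri< A<T _ _ with augment iA iT A<T
    ... | g , g∈T , g∉A , iA+g
      with grow m (ℕ.≤-trans (ℕ.≤-trans T≤ (ℕ.≤-reflexive (sym (ℕ.+-suc m _)))) (ℕ.+-monoʳ-≤ m (∣p∣<∣insert∣ g∉A)))
                iA+g (p⊆p∪q ⁅ g ⁆ f∈A) (insert-⊆ A⊆ (p⊆p∪q ⁅ f ⁆ g∈T))
    ...   | inj₁ i = inj₁ i
    ...   | inj₂ (e , e∈T , e∉A+g , i) = inj₂ (e , e∈T , e∉A+g ∘ p⊆p∪q ⁅ g ⁆ , i)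
    -- An element of `A` that augments `T` lies outside `T`, so it can only be `f`.
    grow m T≤ iA f∈A A⊆ | tri> _ _ T<A with augment iT iA T<A
    ... | g , g∈A , g∉T , iT+g with ∈-insert⁻ T (A⊆ g∈A)
    ...   | inj₁ g∈T  = contradiction g∈T g∉T
    ...   | inj₂ refl = inj₁ iT+g
    grow m {A} T≤ iA f∈A A⊆ | tri≈ _ A≡T _ with T ⊆? A
    ... | yes T⊆A = inj₁ (⊆-indep (insert-⊆ T⊆A f∈A) iA)
    ... | no  T⊈A with ⊈-witness T⊈A
    -- `A` avoids `e`, so it lies in `T - e` with `f` added, which is no larger than `A`; the two
    -- sets coincide.
    ...   | e , e∈T , e∉A = inj₂ (e , e∈T , e∉A , ⊆-indep T′⊆A iA)
      where
      T′ = (T - e) ∪ ⁅ f ⁆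
      A⊆T′ : A ⊆ T′
      A⊆T′ x∈A with ∈-insert⁻ T (A⊆ x∈A)
      ... | inj₁ x∈T  = p⊆p∪q ⁅ f ⁆ (x∈p∧x≢y⇒x∈p-y x∈T λ { refl → e∉A x∈A })
      ... | inj₂ refl = ∈-insert (T - e) f
      ∣T′∣≤∣A∣ : ∣ T′ ∣ ℕ.≤ ∣ A ∣
      ∣T′∣≤∣A∣ = ℕ.≤-trans (∣insert∣≤ (T - e) f) (ℕ.≤-trans (x∈p⇒∣p-x∣<∣p∣ e∈T) (ℕ.≤-reflexive (sym A≡T)))
      T′⊆A : T′ ⊆ A
      T′⊆A {x} x∈T′ = decidable-stable (x ∈? A) λ x∉A →
        ℕ.<⇒≱ (p⊂q⇒∣p∣<∣q∣ (A⊆T′ , x , x∈T′ , x∉A)) ∣T′∣≤∣A∣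

  -- If D spans f but S - f does not, then S - f does not span D.
  replace : ∀ {S D f} → Indep S → Indep D → f ∈ S → ¬ Indep (D ∪ ⁅ f ⁆) →
            ∃[ e ] (e ∈ D × e ∉ S × Indep ((S - f) ∪ ⁅ e ⁆))
  replace {S} {D} {f} iS iD f∈S dep =
    grow ∣ S ∣ (ℕ.m≤m+n _ _) iD (λ x∈D → x∈D) inj₂
    where
    grow : ∀ m {X} → ∣ S ∣ ℕ.≤ m ℕ.+ ∣ X ∣ → Indep X → D ⊆ X → (∀ {x} → x ∈ X → x ∈ S ⊎ x ∈ D) →
           ∃[ e ] (e ∈ D × e ∉ S × Indep ((S - f) ∪ ⁅ e ⁆))
    grow m {X} S≤ iX D⊆X X⊆ with ∣ X ∣ ℕ.<? ∣ S ∣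
    grow zero S≤ iX D⊆X X⊆ | yes X<S = contradiction S≤ (ℕ.<⇒≱ X<S)
    grow (suc m) S≤ iX D⊆X X⊆ | yes X<S with augment iX iS X<S
    ... | s , s∈S , s∉X , iX+s =
      grow m (ℕ.≤-trans (ℕ.≤-trans S≤ (ℕ.≤-reflexive (sym (ℕ.+-suc m _)))) (ℕ.+-monoʳ-≤ m (∣p∣<∣insert∣ s∉X)))
           iX+s (p⊆p∪q ⁅ s ⁆ ∘ D⊆X) λ x∈ → [ X⊆ , (λ { refl → inj₁ s∈S }) ]′ (∈-insert⁻ _ x∈)
    -- `S - f` is smaller than `X`, so some `e` in `X` augments it. Since `X` contains `D`, it
    -- cannot contain `f`; hence `e` is outside `S` and must come from `D`.
    grow m {X} S≤ iX D⊆X X⊆ | no X≮S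
      with augment (⊆-indep (p─q⊆p S ⁅ f ⁆) iS) iX (ℕ.≤-trans (x∈p⇒∣p-x∣<∣p∣ f∈S) (ℕ.≮⇒≥ X≮S))
    ... | e , e∈X , e∉S-f , i = e , [ flip contradiction e∉S , (λ e∈D → e∈D) ]′ (X⊆ e∈X) , e∉S , i
      where
      f∉X : f ∉ X
      f∉X f∈X = dep (⊆-indep (insert-⊆ D⊆X f∈X) iX)
      e∉S : e ∉ S
      e∉S e∈S = e∉S-f (x∈p∧x≢y⇒x∈p-y e∈S λ { refl → f∉X e∈X })

  -- The set D is the fundamental circuit of f in T, without f.
  symmetric-exchange : ∀ {S T f} → Indep S → Indep T → f ∈ S →
    Indep (T ∪ ⁅ f ⁆) ⊎
    ∃[ e ] (e ∈ T × e ∉ S × Indep ((S - f) ∪ ⁅ e ⁆) × Indep ((T - e) ∪ ⁅ f ⁆))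
  symmetric-exchange {S} {T} {f} iS iT f∈S with indep? (T ∪ ⁅ f ⁆)
  ... | yes i  = inj₁ i
  ... | no dep = inj₂ result
    where
    exchangeable? = λ e → (e ∈? T) ×-dec indep? ((T - e) ∪ ⁅ f ⁆)
    D = comprehension exchangeable?
    D⊆T : D ⊆ T
    D⊆T e∈D = proj₁ (∈-comprehension⁻ exchangeable? e∈D)
    -- Otherwise `trade` would either make `T` with `f` independent or produce an exchangeable
    -- element outside `D`.
    D+f-dep : ¬ Indep (D ∪ ⁅ f ⁆)
    D+f-dep i with trade i iT (∈-insert D f) (insert-mono D⊆T)
    ... | inj₁ i′ = dep i′
    ... | inj₂ (e , e∈T , e∉D+f , i′) = e∉D+f (p⊆p∪q ⁅ f ⁆ (∈-comprehension⁺ exchangeable? (e∈T , i′)))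
    result : ∃[ e ] (e ∈ T × e ∉ S × Indep ((S - f) ∪ ⁅ e ⁆) × Indep ((T - e) ∪ ⁅ f ⁆))
    result with replace iS (⊆-indep D⊆T iT) f∈S D+f-dep
    ... | e , e∈D , e∉S , i = e , D⊆T e∈D , e∉S , i , proj₂ (∈-comprehension⁻ exchangeable? e∈D)

-- Maximum-weight independent sets

module _ {c ℓ₁ ℓ₂} (G : OrderedAbelianGroup c ℓ₁ ℓ₂) where
  open OrderedAbelianGroup G
  open AbelianGroup abelianGroup using (∙-congˡ; ∙-congʳ; assoc; comm; identityˡ; identityʳ; inverseʳ)
    renaming (refl to ≈-refl; sym to ≈-sym; trans to ≈-trans; reflexive to ≈-reflexive)
  open IsDecTotalOrder isDecTotalOrder using (total) renaming (refl to ≤-refl; trans to ≤-trans; reflexive to ≤-reflexive)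

  +-cancelʳ-≤ : ∀ {x y} z → x + z ≤ y + z → x ≤ y
  +-cancelʳ-≤ {x} {y} z le =
    ≤-trans (≤-reflexive (≈-sym (undo x))) (≤-trans (+-mono-≤ le ≤-refl) (≤-reflexive (undo y)))
    where
    undo : ∀ u → (u + z) + (- z) ≈ u
    undo u = ≈-trans (assoc u z (- z)) (≈-trans (∙-congˡ (inverseʳ z)) (identityʳ u))

  x≤x+y : ∀ x {y} → 0# ≤ y → x ≤ x + y
  x≤x+y x 0≤y = ≤-trans (≤-reflexive (≈-sym (identityʳ x))) (+-mono-≤ ≤-refl 0≤y)

  weight-insert : ∀ {n} (w : Fin n → Carrier) (A : Subset n) {x} → x ∉ A →
                  weight G w (A ∪ ⁅ x ⁆) ≈ weight G w A + w x
  weight-insert w (true ∷ A) {zero} x∉A = contradiction here x∉A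
  weight-insert w (false ∷ A) {zero} x∉A rewrite ∪-identityʳ A =
    ≈-trans (comm _ _) (∙-congʳ (≈-sym (identityˡ _)))
  weight-insert w (true ∷ A) {suc x} x∉A =
    ≈-trans (∙-congˡ (weight-insert (w ∘ suc) A (x∉A ∘ there))) (≈-sym (assoc _ _ _))
  weight-insert w (false ∷ A) {suc x} x∉A =
    ≈-trans (∙-congˡ (weight-insert (w ∘ suc) A (x∉A ∘ there))) (≈-sym (assoc _ _ _))

  weight-delete : ∀ {n} (w : Fin n → Carrier) {A : Subset n} {x} → x ∈ A →
                  weight G w A ≈ weight G w (A - x) + w x
  weight-delete w {A} {x} x∈A = ≈-trans
    (≈-reflexive (cong (weight G w) (sym (insert-delete x∈A))))
    (weight-insert w (A - x) λ x∈A-x → ∈-delete⇒≢ A x∈A-x refl)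

  module _ {n} (M : Matroid n) (w : Fin n → Carrier) where
    open Matroid M

    private
      wt : Subset n → Carrier
      wt = weight G w

    -- Written without subtraction, so that swaps in two sets can be compared and a common term
    -- cancelled.
    weight-swap : ∀ {A x y} → x ∈ A → y ∉ A → wt ((A - x) ∪ ⁅ y ⁆) + w x ≈ wt A + w y
    weight-swap {A} {x} {y} x∈A y∉A =
      ≈-trans (∙-congʳ (weight-insert w (A - x) (y∉A ∘ p─q⊆p A ⁅ x ⁆)))
      (≈-trans (assoc _ _ _) (≈-trans (∙-congˡ (comm _ _)) (≈-trans (≈-sym (assoc _ _ _))
      (∙-congʳ (≈-sym (weight-delete w x∈A))))))

    OptimalAvoiding : Subset n → Pred (Subset n) ℓ₂
    OptimalAvoiding F T = Indep T × T ⊆ ∁ F × (∀ {A} → Indep A → A ⊆ ∁ F → wt A ≤ wt T)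

    optimalAvoiding : ∀ F → ∃[ T ] OptimalAvoiding F T
    optimalAvoiding F
      with argmax total ≤-trans (λ T → indep? T ×-dec (T ⊆? ∁ F)) wt (∅ , ∅-indep , ⊥⊆)
    ... | T , (iT , T⊆) , max = T , iT , T⊆ , λ iA A⊆ → max (iA , A⊆)

    ⊆∁∅ : ∀ {A : Subset n} → A ⊆ ∁ ∅
    ⊆∁∅ _ = x∉p⇒x∈∁p ∉⊥

    -- For T optimal after the failure of f, exchange f ∈ S for e ∈ T: the set T - e + f weighs at
    -- most as much as S, which rearranges to T weighing at most as much as S - f + e.
    repair : ∀ {F S f} → f ∈ F → OptimalAvoiding (F - f) S →
             ∃[ T ] (OptimalAvoiding F T × S - f ⊆ T × ∃[ e ] (T ⊆ S ∪ ⁅ e ⁆))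
    repair {F} {S} {f} f∈F (iS , S⊆ , S-max) with f ∈? S
    -- `S` already avoids `F`, so nothing is inserted and the witness `f` for the insertion is a
    -- dummy.
    ... | no f∉S = S , (iS , S⊆∁F , λ iA A⊆ → S-max iA (weaken A⊆)) , p─q⊆p S ⁅ f ⁆ , f , p⊆p∪q ⁅ f ⁆
      where
      weaken : ∀ {A} → A ⊆ ∁ F → A ⊆ ∁ (F - f)
      weaken A⊆ = p⊆q⇒∁p⊇∁q (p─q⊆p F ⁅ f ⁆) ∘ A⊆
      S⊆∁F : S ⊆ ∁ F
      S⊆∁F x∈S = x∉p⇒x∈∁p λ x∈F →
        x∈∁p⇒x∉p (S⊆ x∈S) (x∈p∧x≢y⇒x∈p-y x∈F λ { refl → f∉S x∈S })
    ... | yes f∈S with optimalAvoiding F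
    ... | T , iT , T⊆ , T-max = result (symmetric-exchange M iS iT f∈S)
      where
      S-f⊆∁F : S - f ⊆ ∁ F
      S-f⊆∁F x∈ = x∉p⇒x∈∁p λ x∈F →
        x∈∁p⇒x∉p (S⊆ (p─q⊆p S ⁅ f ⁆ x∈)) (x∈p∧x≢y⇒x∈p-y x∈F (∈-delete⇒≢ S x∈))
      T+f⊆ : ∀ {A} → A ⊆ T → A ∪ ⁅ f ⁆ ⊆ ∁ (F - f)
      T+f⊆ A⊆T = insert-⊆ (p⊆q⇒∁p⊇∁q (p─q⊆p F ⁅ f ⁆) ∘ T⊆ ∘ A⊆T) (x∉p⇒x∈∁p λ f∈ → ∈-delete⇒≢ F f∈ refl)
      f∉T : f ∉ T
      f∉T f∈T = x∈∁p⇒x∉p (T⊆ f∈T) f∈F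
      result : Indep (T ∪ ⁅ f ⁆) ⊎
               ∃[ e ] (e ∈ T × e ∉ S × Indep ((S - f) ∪ ⁅ e ⁆) × Indep ((T - e) ∪ ⁅ f ⁆)) →
               ∃[ T ] (OptimalAvoiding F T × S - f ⊆ T × ∃[ e ] (T ⊆ S ∪ ⁅ e ⁆))
      -- `T` with `f` competes with `S`; cancelling `w f` shows that `S - f` is already optimal, and
      -- `f` is again a dummy insertion.
      result (inj₁ i) = S - f ,
        (⊆-indep (p─q⊆p S ⁅ f ⁆) iS , S-f⊆∁F , λ iA A⊆ → ≤-trans (T-max iA A⊆) T≤S-f) ,
        (λ x∈ → x∈) , f , p⊆p∪q ⁅ f ⁆ ∘ p─q⊆p S ⁅ f ⁆
        where
        T≤S-f : wt T ≤ wt (S - f)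
        T≤S-f = +-cancelʳ-≤ (w f) (≤-trans (≤-reflexive (≈-sym (weight-insert w T f∉T)))
          (≤-trans (S-max i (T+f⊆ λ x∈ → x∈)) (≤-reflexive (weight-delete w f∈S))))
      result (inj₂ (e , e∈T , e∉S , iS′ , iT′)) = (S - f) ∪ ⁅ e ⁆ ,
        (iS′ , insert-⊆ S-f⊆∁F (T⊆ e∈T) , λ iA A⊆ → ≤-trans (T-max iA A⊆) T≤S′) ,
        p⊆p∪q ⁅ e ⁆ , e , insert-mono (p─q⊆p S ⁅ f ⁆)
        where
        T≤S′ : wt T ≤ wt ((S - f) ∪ ⁅ e ⁆)
        T≤S′ = +-cancelʳ-≤ (w f) (≤-trans (≤-reflexive (≈-sym (weight-swap e∈T f∉T)))
          (≤-trans (+-mono-≤ (S-max iT′ (T+f⊆ (p─q⊆p T ⁅ e ⁆))) ≤-refl)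
          (≤-reflexive (≈-sym (weight-swap f∈S e∉S)))))

    -- Induction on the size of `F`: `repair` passes from `F - f` to `F`, losing at most `f` and
    -- gaining at most one element. The last two conclusions make `T ─ S` a feasible recovery when
    -- `F` has at most `k` elements.
    recover : ∀ {S} → OptimalAvoiding ∅ S → ∀ F →
              ∃[ T ] (OptimalAvoiding F T × S ─ F ⊆ T × ∣ T ─ S ∣ ℕ.≤ ∣ F ∣)
    recover {S} optS F = go ∣ F ∣ F ℕ.≤-refl
      where
      go : ∀ m F → ∣ F ∣ ℕ.≤ m → ∃[ T ] (OptimalAvoiding F T × S ─ F ⊆ T × ∣ T ─ S ∣ ℕ.≤ ∣ F ∣)
      go m F F≤m with nonempty? F
      go m F F≤m | no F-empty rewrite Empty-unique F-empty =
        S , optS , p─q⊆p S ∅ , p⊆q⇒∣p∣≤∣q∣ {q = ∅} λ x∈ → contradiction (p─q⊆p S S x∈) (∈-─⇒∉ S S x∈)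
      go zero F F≤m | yes (f , f∈F) = contradiction F≤m (ℕ.<⇒≱ (ℕ.≤-<-trans ℕ.z≤n (x∈p⇒∣p-x∣<∣p∣ f∈F)))
      go (suc m) F F≤m | yes (f , f∈F)
        with go m (F - f) (ℕ.s≤s⁻¹ (ℕ.≤-trans (x∈p⇒∣p-x∣<∣p∣ f∈F) F≤m))
      ... | T , optT , S⊆T , T─S≤ with repair f∈F optT
      ... | T′ , optT′ , T-f⊆T′ , e , T′⊆ = T′ , optT′ , S⊆T′ ,
        ℕ.≤-trans (p⊆q⇒∣p∣≤∣q∣ T′─S⊆) (ℕ.≤-trans (∣insert∣≤ (T ─ S) e)
          (ℕ.≤-trans (ℕ.s≤s T─S≤) (x∈p⇒∣p-x∣<∣p∣ f∈F)))
        where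
        S⊆T′ : S ─ F ⊆ T′
        S⊆T′ x∈ = T-f⊆T′ (x∈p∧x≢y⇒x∈p-y
          (S⊆T (x∈p∧x∉q⇒x∈p─q (p─q⊆p S F x∈) (∈-─⇒∉ S F x∈ ∘ p─q⊆p F ⁅ f ⁆)))
          λ { refl → ∈-─⇒∉ S F x∈ f∈F })
        T′─S⊆ : T′ ─ S ⊆ (T ─ S) ∪ ⁅ e ⁆
        T′─S⊆ x∈ with ∈-insert⁻ T (T′⊆ (p─q⊆p T′ S x∈))
        ... | inj₁ x∈T  = p⊆p∪q ⁅ e ⁆ (x∈p∧x∉q⇒x∈p─q x∈T (∈-─⇒∉ T′ S x∈))
        ... | inj₂ refl = ∈-insert (T ─ S) e

    -- Values of the three nested optima.

    module _ (k : ℕ) where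
      open Robust G w M k

      recovery? : ∀ S F → Decidable (Recovery S F)
      recovery? S F R = (R ⊆? ∁ (S ∪ F)) ×-dec ((∣ R ∣ ℕ.≤? k) ×-dec indep? ((S ∪ R) ─ F))

      -- Recovering nothing leaves an independent subset of `S`, so the maximum is over a nonempty
      -- family. Thus every failure has a value against every competing first stage.
      recoveryValue : ∀ {S} F → Indep S → ∃ (RecoveryValue S F)
      recoveryValue {S} F iS with argmax total ≤-trans (recovery? S F) (λ R → wt ((S ∪ R) ─ F)) (∅ , ∅-recovery)
        where
        ∅-recovery : Recovery S F ∅
        ∅-recovery = ⊥⊆ , ℕ.≤-trans (ℕ.≤-reflexive (∣⊥∣≡0 n)) ℕ.z≤n ,
          ⊆-indep (λ x∈ → subst (_ ∈_) (∪-identityʳ S) (p─q⊆p (S ∪ ∅) F x∈)) iS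
      ... | R , rec , max = _ , (R , rec , ≈-refl) , λ (R′ , rec′ , u≈) → ≤-trans (≤-reflexive u≈) (max rec′)

      -- Whatever survives the failure avoids `F` and so competes with `T`.
      recoveryValue-≤ : ∀ {S F T v} → OptimalAvoiding F T → RecoveryValue S F v → v ≤ wt T
      recoveryValue-≤ {S} {F} (_ , _ , T-max) ((R , (_ , _ , i) , v≈) , _) =
        ≤-trans (≤-reflexive v≈) (T-max i λ x∈ → x∉p⇒x∈∁p (∈-─⇒∉ (S ∪ R) F x∈))

      module _ {S} (optS : OptimalAvoiding ∅ S) where

        -- The recovery is `T ─ S`: joined to `S` and stripped of `F` it gives exactly `T`, because
        -- `T` avoids `F` and contains `S ─ F`.
        recovered-value : ∀ {F} → ∣ F ∣ ℕ.≤ k → RecoveryValue S F (wt (proj₁ (recover optS F)))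
        recovered-value {F} F≤k with recover optS F
        ... | T , (iT , T⊆ , T-max) , S─F⊆T , T─S≤ =
          (T ─ S , (R⊆ , ℕ.≤-trans T─S≤ F≤k , subst Indep T≡ iT) , ≈-reflexive (cong wt T≡)) ,
          λ { (R , (_ , _ , i) , u≈) → ≤-trans (≤-reflexive u≈)
                (T-max i λ x∈ → x∉p⇒x∈∁p (∈-─⇒∉ (S ∪ R) F x∈)) }
          where
          R⊆ : T ─ S ⊆ ∁ (S ∪ F)
          R⊆ x∈ = x∉p⇒x∈∁p λ x∈S∪F →
            [ ∈-─⇒∉ T S x∈ , x∈∁p⇒x∉p (T⊆ (p─q⊆p T S x∈)) ]′ (x∈p∪q⁻ S F x∈S∪F)
          T⊆S∪R─F : T ⊆ (S ∪ (T ─ S)) ─ F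
          T⊆S∪R─F {x} x∈T = x∈p∧x∉q⇒x∈p─q x∈S∪R (x∈∁p⇒x∉p (T⊆ x∈T))
            where
            x∈S∪R : x ∈ S ∪ (T ─ S)
            x∈S∪R with x ∈? S
            ... | yes x∈S = p⊆p∪q (T ─ S) x∈S
            ... | no  x∉S = q⊆p∪q S (T ─ S) (x∈p∧x∉q⇒x∈p─q x∈T x∉S)
          S∪R─F⊆T : (S ∪ (T ─ S)) ─ F ⊆ T
          S∪R─F⊆T x∈ with x∈p∪q⁻ S (T ─ S) (p─q⊆p (S ∪ (T ─ S)) F x∈)
          ... | inj₁ x∈S = S─F⊆T (x∈p∧x∉q⇒x∈p─q x∈S (∈-─⇒∉ (S ∪ (T ─ S)) F x∈))
          ... | inj₂ x∈R = p─q⊆p T S x∈R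
          T≡ : T ≡ (S ∪ (T ─ S)) ─ F
          T≡ = ⊆-antisym T⊆S∪R─F S∪R─F⊆T

        -- The weight recovered after `F` is the optimum for `F`, which does not depend on `S`. A
        -- failure `F₀` minimising it is worst for `S`, and the same `F₀` holds every other first
        -- stage to at most that value.
        optimal-first-stage : IsOptimalFirstStage S
        optimal-first-stage
          with argmax (flip total) (flip ≤-trans) (λ F → ∣ F ∣ ℕ.≤? k) (λ F → wt (proj₁ (recover optS F)))
                      (∅ , ℕ.≤-trans (ℕ.≤-reflexive (∣⊥∣≡0 n)) ℕ.z≤n)
        ... | F₀ , F₀≤k , min = proj₁ optS , v , value , (S , proj₁ optS , value) , bound
          where
          v : Carrier
          v = wt (proj₁ (recover optS F₀))
          value : FirstStageValue S v
          value = (F₀ , F₀≤k , recovered-value F₀≤k) ,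
            λ (F , F≤k , _ , u-max) → ≤-trans (min F≤k) (u-max (proj₁ (recovered-value F≤k)))
          bound : ∀ {u} → ∃[ S′ ] (Indep S′ × FirstStageValue S′ u) → u ≤ v
          bound (S′ , iS′ , _ , u-min) with recoveryValue F₀ iS′
          ... | v′ , rv = ≤-trans (u-min (F₀ , F₀≤k , rv)) (recoveryValue-≤ (proj₁ (proj₂ (recover optS F₀))) rv)

    -- Augmenting an independent set from `B` never lowers its weight; once it is as large as `B` it
    -- is itself a basis, and `B` is a heaviest one.
    maxWeightBasis-optimal : (∀ e → 0# ≤ w e) → ∀ {B} → IsMaxWeightBasis G w M B → OptimalAvoiding ∅ B
    maxWeightBasis-optimal 0≤w {B} ((iB , B-maximal) , B-max) =
      iB , ⊆∁∅ , λ iA _ → extend ∣ B ∣ (ℕ.m≤m+n _ _) iA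
      where
      extend : ∀ m {A} → ∣ B ∣ ℕ.≤ m ℕ.+ ∣ A ∣ → Indep A → wt A ≤ wt B
      extend m {A} B≤ iA with ∣ A ∣ ℕ.<? ∣ B ∣
      extend zero B≤ iA | yes A<B = contradiction B≤ (ℕ.<⇒≱ A<B)
      extend (suc m) {A} B≤ iA | yes A<B with augment iA iB A<B
      ... | e , _ , e∉A , iA+e = ≤-trans (x≤x+y (wt A) (0≤w e))
        (≤-trans (≤-reflexive (≈-sym (weight-insert w A e∉A)))
        (extend m (ℕ.≤-trans (ℕ.≤-trans B≤ (ℕ.≤-reflexive (sym (ℕ.+-suc m _)))) (ℕ.+-monoʳ-≤ m (∣p∣<∣insert∣ e∉A))) iA+e))
      extend m {A} B≤ iA | no A≮B = B-max (iA , λ {C} iC A⊆C → ⊆-antisym (C⊆A iC A⊆C) A⊆C)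
        where
        C⊆A : ∀ {C} → Indep C → A ⊆ C → C ⊆ A
        -- A proper independent superset of `A` would be larger than `B` and augment it, against
        -- maximality.
        C⊆A iC A⊆C {x} x∈C = decidable-stable (x ∈? A) λ x∉A →
          let e , _ , e∉B , iB+e = augment iB iC (ℕ.≤-<-trans (ℕ.≮⇒≥ A≮B) (p⊂q⇒∣p∣<∣q∣ (A⊆C , x , x∈C , x∉A)))
          in e∉B (subst (e ∈_) (B-maximal iB+e (p⊆p∪q ⁅ e ⁆)) (∈-insert B e))

    -- Correctness of the greedy choice.

    -- The loop invariant: some maximum-weight independent set `O` meets the processed elements `P`
    -- exactly in the selected ones, `S`.
    Greedy : (S P : Subset n) → Set ℓ₂
    Greedy S P = S ⊆ P × ∃[ O ] (OptimalAvoiding ∅ O × S ⊆ O × (∀ {x} → x ∈ O → x ∈ S ⊎ x ∉ P))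

    greedy-start : Greedy ∅ ∅
    greedy-start with optimalAvoiding ∅
    ... | O , optO = ⊥⊆ , O , optO , ⊥⊆ , λ _ → inj₂ ∉⊥

    -- No independent set containing `S` can contain `e`, so the same `O` remains a witness.
    greedy-reject : ∀ {S P e} → Greedy S P → ¬ Indep (S ∪ ⁅ e ⁆) → Greedy S (P ∪ ⁅ e ⁆)
    greedy-reject {S} {P} {e} (S⊆P , O , optO , S⊆O , O⊆) dep =
      p⊆p∪q ⁅ e ⁆ ∘ S⊆P , O , optO , S⊆O , O⊆′
      where
      O⊆′ : ∀ {x} → x ∈ O → x ∈ S ⊎ x ∉ P ∪ ⁅ e ⁆
      O⊆′ x∈O with O⊆ x∈O
      ... | inj₁ x∈S = inj₁ x∈S
      ... | inj₂ x∉P = inj₂ λ x∈ → [ x∉P , (λ { refl → dep (⊆-indep (insert-⊆ S⊆O x∈O) (proj₁ optO)) }) ]′ (∈-insert⁻ P x∈)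

    Heaviest : Subset n → Fin n → Set ℓ₂
    Heaviest P e = ∀ g → g ∉ P → 0# ≤ w g → w g ≤ w e

    -- If `O` misses `e`, either `e` can be added without loss, or `trade` gives up some `g` outside
    -- `S` for `e`. As `O` agrees with `S` on `P`, `g` is unprocessed and hence no heavier than `e`.
    greedy-accept : ∀ {S P e} → Greedy S P → 0# ≤ w e → Heaviest P e →
                    Indep (S ∪ ⁅ e ⁆) → Greedy (S ∪ ⁅ e ⁆) (P ∪ ⁅ e ⁆)
    greedy-accept {S} {P} {e} (S⊆P , O , optO@(iO , _ , O-max) , S⊆O , O⊆) 0≤we heaviest iS+e =
      insert-mono S⊆P , next
      where
      settle : ∀ {Q x} → Q ⊆ O ∪ ⁅ e ⁆ → x ∈ Q → x ∈ S ∪ ⁅ e ⁆ ⊎ x ∉ P ∪ ⁅ e ⁆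
      settle {x = x} Q⊆ x∈Q with x ≟ e
      ... | yes refl = inj₁ (∈-insert S e)
      ... | no x≢e with ∈-insert⁻ O (Q⊆ x∈Q)
      ...   | inj₂ x≡e = contradiction x≡e x≢e
      ...   | inj₁ x∈O with O⊆ x∈O
      ...     | inj₁ x∈S = inj₁ (p⊆p∪q ⁅ e ⁆ x∈S)
      ...     | inj₂ x∉P = inj₂ λ x∈ → [ x∉P , x≢e ]′ (∈-insert⁻ P x∈)

      lighter : ∀ {g} → g ∉ P → w g ≤ w e
      lighter {g} g∉P with 0# ≤? w g
      ... | yes 0≤wg = heaviest g g∉P 0≤wg
      ... | no  0≰wg = [ flip contradiction 0≰wg , (λ wg≤0 → ≤-trans wg≤0 0≤we) ]′ (total 0# (w g))

      at-least : ∀ {Q} → Indep Q → wt O ≤ wt Q → OptimalAvoiding ∅ Q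
      at-least iQ O≤Q = iQ , ⊆∁∅ , λ iA A⊆ → ≤-trans (O-max iA A⊆) O≤Q

      next : ∃[ Q ] (OptimalAvoiding ∅ Q × S ∪ ⁅ e ⁆ ⊆ Q × (∀ {x} → x ∈ Q → x ∈ S ∪ ⁅ e ⁆ ⊎ x ∉ P ∪ ⁅ e ⁆))
      next with e ∈? O
      ... | yes e∈O = O , optO , insert-⊆ S⊆O e∈O , settle (p⊆p∪q ⁅ e ⁆)
      ... | no  e∉O with trade M iS+e iO (∈-insert S e) (insert-mono S⊆O)
      ...   | inj₁ i = O ∪ ⁅ e ⁆ , at-least i
              (≤-trans (x≤x+y (wt O) 0≤we) (≤-reflexive (≈-sym (weight-insert w O e∉O)))) ,
              insert-mono S⊆O , settle λ x∈ → x∈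
      ...   | inj₂ (g , g∈O , g∉S+e , i) = (O - g) ∪ ⁅ e ⁆ , at-least i O≤ ,
              insert-mono (λ x∈S → x∈p∧x≢y⇒x∈p-y (S⊆O x∈S) λ { refl → g∉S+e (p⊆p∪q ⁅ e ⁆ x∈S) }) ,
              settle (insert-mono (p─q⊆p O ⁅ g ⁆))
        where
        g∉P : g ∉ P
        g∉P = [ (λ g∈S → contradiction (p⊆p∪q ⁅ e ⁆ g∈S) g∉S+e) , (λ g∉P → g∉P) ]′ (O⊆ g∈O)
        O≤ : wt O ≤ wt ((O - g) ∪ ⁅ e ⁆)
        O≤ = +-cancelʳ-≤ (w g) (≤-trans (+-mono-≤ ≤-refl (lighter g∉P)) (≤-reflexive (≈-sym (weight-swap g∈O e∉O))))

    -- Deleting an element from an optimal set cannot gain weight, so all elements of `O` have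
    -- nonnegative weight. Such elements are all processed, and thus `O` is `S`.
    greedy-end : ∀ {S P} → Greedy S P → (∀ e → e ∉ P → ¬ (0# ≤ w e)) → OptimalAvoiding ∅ S
    greedy-end {S} (_ , O , optO@(iO , _ , O-max) , S⊆O , O⊆) done = subst (OptimalAvoiding ∅) (⊆-antisym O⊆S S⊆O) optO
      where
      O⊆S : O ⊆ S
      O⊆S {x} x∈O with O⊆ x∈O
      ... | inj₁ x∈S = x∈S
      ... | inj₂ x∉P = contradiction 0≤wx (done x x∉P)
        where
        0≤wx : 0# ≤ w x
        0≤wx = +-cancelʳ-≤ (wt (O - x)) (≤-trans (≤-reflexive (identityˡ _))
          (≤-trans (O-max (⊆-indep (p─q⊆p O ⁅ x ⁆) iO) ⊆∁∅)
          (≤-reflexive (≈-trans (weight-delete w x∈O) (comm _ _)))))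

-- The greedy algorithm

-- Number register 2 holds the candidate and register 3 the scanning index; a candidate equal to n
-- means that there is none.  Set register 0 holds the solution and set register 1 the elements
-- already processed.
scanStep scan process greedyStep greedy : Program
scanStep = ifᵖ (3 ∈ᵗ 1) skip (ifᵖ (0≤ʷ 3) (ifᵖ (3 ≤ʷ 2) skip (2 ≔ 3)) skip)
scan = (2 ≔ 0) ⨾ zeroᵖ 3 ⨾ whileᵖ (3 <ᵗ 0) (scanStep ⨾ incᵖ 3)
-- The oracle reads a set register, so the candidate is inserted before the test and taken out again
-- on failure.
process = insertᵖ 2 1 ⨾ insertᵖ 2 0 ⨾ ifᵖ (indepᵗ 0) skip (deleteᵖ 2 0)
greedyStep = scan ⨾ ifᵖ (2 <ᵗ 0) process skip
greedy = whileᵖ (2 <ᵗ 0) greedyStep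

element-toℕ : ∀ {n} (e : Fin n) → element n (toℕ e) ≡ just e
element-toℕ {n} e with toℕ e ℕ.<? n
... | yes e<n = cong just (fromℕ<-toℕ e e<n)
... | no  e≮n = contradiction (toℕ<n e) e≮n

element-n : ∀ n → element n n ≡ nothing
element-n n with n ℕ.<? n
... | yes n<n = contradiction n<n (ℕ.<-irrefl refl)
... | no  _   = refl

does-true : ∀ {a} {A : Set a} (A? : Dec A) → does A? ≡ true → A
does-true (yes a) _ = a

does-false : ∀ {a} {A : Set a} (A? : Dec A) → does A? ≡ false → ¬ A
does-false (no ¬a) _ = ¬a

-- The main loop makes at most `n + 1` iterations and one last failing test. The second summand is
-- the slack that turns the quadratic bound into a polynomial identity.
running-time : ∀ n → suc (suc n ℕ.* suc ((3 ℕ.+ n ℕ.* 6) ℕ.+ 5)) ℕ.+ (4 ℕ.* (n ℕ.* n) ℕ.+ 5 ℕ.* n) ≡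
                     10 ℕ.* (suc n ℕ.* (suc n ℕ.* 1))
running-time = solve-∀

module _ {c ℓ₁ ℓ₂} (G : OrderedAbelianGroup c ℓ₁ ℓ₂) {n} (M : Matroid n)
         (w : Fin n → OrderedAbelianGroup.Carrier G) where
  open OrderedAbelianGroup G
  open IsDecTotalOrder isDecTotalOrder using (total) renaming (refl to ≤-refl; trans to ≤-trans)
  open Matroid M
  open Machine G w M

  -- Total correctness with step bounds.

  Halts : ∀ {q} → Program → State n → ℕ → Pred (State n) q → Set q
  Halts p s b Q = ∃[ t ] ∃[ s′ ] (Run p s t s′ × t ℕ.≤ b × Q s′)

  halts-⨾ : ∀ {q r p p′ s b b′} {Q : Pred (State n) q} {R : Pred (State n) r} →
            Halts p s b Q → (∀ {s′} → Q s′ → Halts p′ s′ b′ R) → Halts (p ⨾ p′) s (b ℕ.+ b′) R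
  halts-⨾ (t , s′ , run , t≤ , q) next with next q
  ... | t′ , s″ , run′ , t′≤ , r = t ℕ.+ t′ , s″ , run ⨾ run′ , ℕ.+-mono-≤ t≤ t′≤ , r

  halts-if : ∀ {q e p p′ s b} {Q : Pred (State n) q} →
             (test e s ≡ true → Halts p s b Q) → (test e s ≡ false → Halts p′ s b Q) →
             Halts (ifᵖ e p p′) s (suc b) Q
  halts-if {e = e} {s = s} yes-case no-case with test e s in eq
  ... | true  = let t , s′ , run , t≤ , q = yes-case refl in suc t , s′ , if-true eq run , ℕ.s≤s t≤ , q
  ... | false = let t , s′ , run , t≤ , q = no-case refl in suc t , s′ , if-false eq run , ℕ.s≤s t≤ , q

  -- The index of `I` bounds the remaining iterations. Each costs one step for the test besides the
  -- body, and the final failing test costs one more.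
  halts-while : ∀ {i e p b} (I : ℕ → Pred (State n) i) →
                (∀ s → I 0 s → test e s ≡ false) →
                (∀ {m s} → I (suc m) s → test e s ≡ true → Halts p s b (I m)) →
                ∀ m {s} → I m s →
                Halts (whileᵖ e p) s (suc (m ℕ.* suc b)) (λ s′ → (∃[ m′ ] I m′ s′) × test e s′ ≡ false)
  halts-while {e = e} I stop step m {s} i with test e s in eq
  ... | false = 1 , s , while-false eq , ℕ.s≤s ℕ.z≤n , (m , i) , eq
  halts-while I stop step zero i | true with trans (sym eq) (stop _ i)
  ... | ()
  halts-while {b = b} I stop step (suc m) i | true with step i eq
  ... | t , s′ , run , t≤ , i′ with halts-while I stop step m i′
  ...   | t′ , s″ , run′ , t′≤ , q = suc (t ℕ.+ t′) , s″ , while-true eq run run′ ,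
          ℕ.s≤s (ℕ.≤-trans (ℕ.+-mono-≤ t≤ t′≤) (ℕ.≤-reflexive (ℕ.+-suc b _))) , q

  halts-skip : ∀ {q s b} {Q : Pred (State n) q} → Q s → Halts skip s (suc b) Q
  halts-skip q = 1 , _ , skip , ℕ.s≤s ℕ.z≤n , q

  halts-≔ : ∀ {q x y s b} {Q : Pred (State n) q} →
            Q ⟨ num s [ x ↦ num s y ] , set s ⟩ → Halts (x ≔ y) s (suc b) Q
  halts-≔ q = 1 , _ , assign , ℕ.s≤s ℕ.z≤n , q

  halts-insert : ∀ {q x a s e} {Q : Pred (State n) q} → element n (num s x) ≡ just e →
                 Q ⟨ num s , set s [ a ↦ set s a ∪ ⁅ e ⁆ ] ⟩ → Halts (insertᵖ x a) s 1 Q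
  halts-insert {x = x} {a} {s} eq q = 1 , _ , run , ℕ.≤-refl , q
    where
    run : Run (insertᵖ x a) s 1 _
    run = subst (λ m → Run (insertᵖ x a) s 1 (maybe′ _ s m)) eq insertᵖ

  halts-delete : ∀ {q x a s e} {Q : Pred (State n) q} → element n (num s x) ≡ just e →
                 Q ⟨ num s , set s [ a ↦ set s a ─ ⁅ e ⁆ ] ⟩ → Halts (deleteᵖ x a) s 1 Q
  halts-delete {x = x} {a} {s} eq q = 1 , _ , run , ℕ.≤-refl , q
    where
    run : Run (deleteᵖ x a) s 1 _
    run = subst (λ m → Run (deleteᵖ x a) s 1 (maybe′ _ s m)) eq deleteᵖ

  test-∈ : ∀ {x a s e} → element n (num s x) ≡ just e → test (x ∈ᵗ a) s ≡ lookup (set s a) e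
  test-∈ eq rewrite eq = refl

  test-0≤ : ∀ {x s e} → element n (num s x) ≡ just e → test (0≤ʷ x) s ≡ does (0# ≤? w e)
  test-0≤ eq rewrite eq = refl

  test-≤ : ∀ {x y s e f} → element n (num s x) ≡ just e → element n (num s y) ≡ just f →
           test (x ≤ʷ y) s ≡ does (w e ≤? w f)
  test-≤ eq eq′ rewrite eq | eq′ = refl

  test-≤-nothing : ∀ {x y s e} → element n (num s x) ≡ just e → element n (num s y) ≡ nothing →
                   test (x ≤ʷ y) s ≡ false
  test-≤-nothing eq eq′ rewrite eq | eq′ = refl

  -- The scan for a heaviest unprocessed element.

  -- The scan invariant after `j` indices: `m` encodes the running maximum over unprocessed elements
  -- of nonnegative weight, with `n` as the sentinel for none.
  Candidate : Subset n → ℕ → ℕ → Set ℓ₂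
  Candidate P j m =
    (m ≡ n × (∀ g → toℕ g ℕ.< j → g ∉ P → ¬ (0# ≤ w g))) ⊎
    ∃[ e ] (m ≡ toℕ e × e ∉ P × 0# ≤ w e × (∀ g → toℕ g ℕ.< j → g ∉ P → 0# ≤ w g → w g ≤ w e))

  toℕ-<-suc : ∀ {g j : Fin n} → toℕ g ℕ.< suc (toℕ j) → toℕ g ℕ.< toℕ j ⊎ g ≡ j
  toℕ-<-suc g<1+j with ℕ.m≤n⇒m<n∨m≡n (ℕ.s≤s⁻¹ g<1+j)
  ... | inj₁ g<j = inj₁ g<j
  ... | inj₂ g≡j = inj₂ (toℕ-injective g≡j)

  candidate-skip : ∀ {P m} (j : Fin n) → (j ∉ P → ¬ (0# ≤ w j)) →
                   Candidate P (toℕ j) m → Candidate P (suc (toℕ j)) m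
  candidate-skip {P} j skip-j (inj₁ (m≡n , none)) = inj₁ (m≡n , none′)
    where
    none′ : ∀ g → toℕ g ℕ.< suc (toℕ j) → g ∉ P → ¬ (0# ≤ w g)
    none′ g g<1+j with toℕ-<-suc g<1+j
    ... | inj₁ g<j  = none g g<j
    ... | inj₂ refl = skip-j
  candidate-skip {P} j skip-j (inj₂ (e , m≡e , e∉P , 0≤we , max)) = inj₂ (e , m≡e , e∉P , 0≤we , max′)
    where
    max′ : ∀ g → toℕ g ℕ.< suc (toℕ j) → g ∉ P → 0# ≤ w g → w g ≤ w e
    max′ g g<1+j g∉P 0≤wg with toℕ-<-suc g<1+j
    ... | inj₁ g<j  = max g g<j g∉P 0≤wg
    ... | inj₂ refl = contradiction 0≤wg (skip-j g∉P)

  candidate-choose : ∀ {P} (j e : Fin n) → e ∉ P → 0# ≤ w e → w j ≤ w e →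
                     (∀ g → toℕ g ℕ.< toℕ j → g ∉ P → 0# ≤ w g → w g ≤ w e) →
                     Candidate P (suc (toℕ j)) (toℕ e)
  candidate-choose {P} j e e∉P 0≤we wj≤we max = inj₂ (e , refl , e∉P , 0≤we , max′)
    where
    max′ : ∀ g → toℕ g ℕ.< suc (toℕ j) → g ∉ P → 0# ≤ w g → w g ≤ w e
    max′ g g<1+j g∉P 0≤wg with toℕ-<-suc g<1+j
    ... | inj₁ g<j  = max g g<j g∉P 0≤wg
    ... | inj₂ refl = wj≤we

  lookup⇒∉ : ∀ {P : Subset n} {x} → lookup P x ≡ false → x ∉ P
  lookup⇒∉ eq x∈P with trans (sym eq) ([]=⇒lookup x∈P)
  ... | ()

  Scanning : (ℕ → Subset n) → ℕ → Pred (State n) ℓ₂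
  Scanning σ j s = num s 0 ≡ n × set s ≡ σ × num s 3 ≡ j × Candidate (σ 1) j (num s 2)

  -- The postcondition is pulled back along the increment of register 3 that follows in the loop
  -- body.
  halts-scanStep : ∀ {σ s} (j : Fin n) → Scanning σ (toℕ j) s →
                   Halts scanStep s 4 (Scanning σ (suc (toℕ j)) ∘ λ s′ → ⟨ num s′ [ 3 ↦ suc (num s′ 3) ] , set s′ ⟩)
  halts-scanStep {σ} {s} j (n≡ , refl , j≡ , cand) = halts-if
    (λ t → halts-skip (skipped λ j∉P → contradiction (lookup⇒[]= j _ (trans (sym test-∈≡) t)) j∉P))
    (λ t → halts-if
      (λ t′ → unprocessed (lookup⇒∉ (trans (sym test-∈≡) t)) (does-true (0# ≤? w j) (trans (sym test-0≤≡) t′)))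
      (λ t′ → halts-skip (skipped λ _ → does-false (0# ≤? w j) (trans (sym test-0≤≡) t′))))
    where
    eq : element n (num s 3) ≡ just j
    eq = trans (cong (element n) j≡) (element-toℕ j)
    test-∈≡ : test (3 ∈ᵗ 1) s ≡ lookup (σ 1) j
    test-∈≡ = test-∈ {a = 1} {s} eq
    test-0≤≡ : test (0≤ʷ 3) s ≡ does (0# ≤? w j)
    test-0≤≡ = test-0≤ {s = s} eq
    Scanned : Pred (State n) ℓ₂
    Scanned s′ = Scanning σ (suc (toℕ j)) ⟨ num s′ [ 3 ↦ suc (num s′ 3) ] , set s′ ⟩
    skipped : (j ∉ σ 1 → ¬ (0# ≤ w j)) → Scanned s
    skipped skip-j = n≡ , refl , cong suc j≡ , candidate-skip j skip-j cand
    unprocessed : j ∉ σ 1 → 0# ≤ w j → Halts (ifᵖ (3 ≤ʷ 2) skip (2 ≔ 3)) s 2 Scanned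
    unprocessed j∉P 0≤wj = compare cand
      where
      chosen : (∀ g → toℕ g ℕ.< toℕ j → g ∉ σ 1 → 0# ≤ w g → w g ≤ w j) →
               Scanned ⟨ num s [ 2 ↦ num s 3 ] , set s ⟩
      chosen max = n≡ , refl , cong suc j≡ ,
        subst (Candidate (σ 1) _) (sym j≡) (candidate-choose j j j∉P 0≤wj ≤-refl max)
      compare : Candidate (σ 1) (toℕ j) (num s 2) → Halts (ifᵖ (3 ≤ʷ 2) skip (2 ≔ 3)) s 2 Scanned
      -- The sentinel `n` denotes no element, so the weight comparison fails and `j` becomes the
      -- first candidate.
      compare (inj₁ (m≡n , none)) = halts-if
        (λ t → contradiction (trans (sym t) (test-≤-nothing {y = 2} {s} eq (trans (cong (element n) m≡n) (element-n n)))) λ ())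
        (λ _ → halts-≔ (chosen λ g g<j g∉P 0≤wg → contradiction 0≤wg (none g g<j g∉P)))
      compare (inj₂ (e , m≡e , e∉P , 0≤we , max)) = halts-if
        (λ t → halts-skip (n≡ , refl , cong suc j≡ , subst (Candidate (σ 1) _) (sym m≡e)
          (candidate-choose j e e∉P 0≤we (does-true (w j ≤? w e) (trans (sym test≡) t)) max)))
        (λ t → halts-≔ (chosen λ g g<j g∉P 0≤wg → ≤-trans (max g g<j g∉P 0≤wg)
          ([ flip contradiction (does-false (w j ≤? w e) (trans (sym test≡) t)) , (λ le → le) ]′ (total (w j) (w e)))))
        where
        test≡ : test (3 ≤ʷ 2) s ≡ does (w j ≤? w e)
        test≡ = test-≤ {y = 2} {s} eq (trans (cong (element n) m≡e) (element-toℕ e))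

  Scanned : (ℕ → Subset n) → Pred (State n) ℓ₂
  Scanned σ s = num s 0 ≡ n × set s ≡ σ × Candidate (σ 1) n (num s 2)

  -- Two initialisations, at most `n` iterations of one test and five further steps, and a final
  -- failing test.
  halts-scan : ∀ {s} → num s 0 ≡ n → Halts scan s (3 ℕ.+ n ℕ.* 6) (Scanned (set s))
  halts-scan {s} n≡ = halts-⨾ (halts-≔ {b = 0} {Q = _≡ s₁} refl) λ { refl →
    halts-⨾ {Q = _≡ s₂} (1 , _ , zeroᵖ , ℕ.≤-refl , refl) λ { refl → finish
      (halts-while I stop step n {s₂} (0 , ℕ.z≤n , ℕ.m≤m+n n 0 , n≡ , refl , refl , inj₁ (n≡ , λ g ()))) } }
    where
    s₁ = ⟨ num s [ 2 ↦ num s 0 ] , set s ⟩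
    s₂ = ⟨ num s₁ [ 3 ↦ 0 ] , set s ⟩
    I : ℕ → Pred (State n) ℓ₂
    I m s′ = ∃[ j ] (j ℕ.≤ n × n ℕ.≤ m ℕ.+ j × Scanning (set s) j s′)
    stop : ∀ s′ → I 0 s′ → test (3 <ᵗ 0) s′ ≡ false
    stop s′ (j , _ , n≤j , n≡′ , _ , refl , _) rewrite n≡′ = dec-false (num s′ 3 ℕ.<? n) (ℕ.≤⇒≯ n≤j)
    step : ∀ {m s′} → I (suc m) s′ → test (3 <ᵗ 0) s′ ≡ true → Halts (scanStep ⨾ incᵖ 3) s′ 5 (I m)
    step {m} {s′} (j , _ , n≤ , n≡′ , set≡ , refl , cand) t =
      halts-⨾ (halts-scanStep (fromℕ< j<n)
        (n≡′ , set≡ , sym j≡ , subst (λ i → Candidate _ i (num s′ 2)) (sym j≡) cand)) λ {s″} scanned →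
      1 , _ , incᵖ , ℕ.≤-refl , suc (num s′ 3) , j<n ,
      ℕ.≤-trans n≤ (ℕ.≤-reflexive (sym (ℕ.+-suc m _))) ,
      subst (λ i → Scanning (set s) (suc i) ⟨ num s″ [ 3 ↦ suc (num s″ 3) ] , set s″ ⟩) j≡ scanned
      where
      j<n : num s′ 3 ℕ.< n
      j<n = subst (num s′ 3 ℕ.<_) n≡′ (does-true (num s′ 3 ℕ.<? num s′ 0) t)
      j≡ : toℕ (fromℕ< j<n) ≡ num s′ 3
      j≡ = toℕ-fromℕ< j<n
    finish : ∀ {b} → Halts (whileᵖ (3 <ᵗ 0) (scanStep ⨾ incᵖ 3)) s₂ b (λ s′ → (∃[ m ] I m s′) × test (3 <ᵗ 0) s′ ≡ false) →
             Halts (whileᵖ (3 <ᵗ 0) (scanStep ⨾ incᵖ 3)) s₂ b (Scanned (set s))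
    finish (t , s′ , run , t≤ , (m , j , j≤n , _ , n≡′ , set≡ , j≡ , cand) , stopped) =
      t , s′ , run , t≤ , n≡′ , set≡ , subst (λ i → Candidate _ i (num s′ 2)) (ℕ.≤-antisym j≤n n≤j) cand
      where
      n≤j : n ℕ.≤ j
      n≤j = subst (n ℕ.≤_) j≡ (subst (ℕ._≤ num s′ 3) n≡′ (ℕ.≮⇒≥ (does-false (num s′ 3 ℕ.<? num s′ 0) stopped)))

  -- The main loop.

  -- On rejection the deletion restores the selection exactly, because `e` is unprocessed while
  -- every selected element is processed.
  halts-process : ∀ {s e} → num s 2 ≡ toℕ e → e ∉ set s 1 → 0# ≤ w e → Heaviest G M w (set s 1) e →
                  Greedy G M w (set s 0) (set s 1) →
                  Halts process s 4 (λ s′ → num s′ ≡ num s × set s′ 1 ≡ set s 1 ∪ ⁅ e ⁆ × Greedy G M w (set s′ 0) (set s′ 1))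
  halts-process {s} {e} m≡e e∉P 0≤we heaviest greedy =
    halts-⨾ (halts-insert {Q = _≡ s₁} eq refl) λ { refl →
    halts-⨾ (halts-insert {Q = _≡ s₂} eq refl) λ { refl → halts-if {e = indepᵗ 0}
      (λ t → halts-skip (refl , refl , greedy-accept G M w greedy 0≤we heaviest (does-true (indep? S+e) t)))
      (λ t → halts-delete eq (refl , refl , subst (λ S → Greedy G M w S (set s 1 ∪ ⁅ e ⁆))
        (sym (delete-insert (e∉P ∘ proj₁ greedy))) (greedy-reject G M w greedy (does-false (indep? S+e) t)))) } }
    where
    S+e = set s 0 ∪ ⁅ e ⁆
    s₁ s₂ : State n
    s₁ = ⟨ num s , set s [ 1 ↦ set s 1 ∪ ⁅ e ⁆ ] ⟩
    s₂ = ⟨ num s , set s₁ [ 0 ↦ S+e ] ⟩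
    eq : element n (num s 2) ≡ just e
    eq = trans (cong (element n) m≡e) (element-toℕ e)

  -- The bound m on the remaining iterations: each one but the last processes a new element.
  Iterating : ℕ → Pred (State n) ℓ₂
  Iterating m s = num s 0 ≡ n × Greedy G M w (set s 0) (set s 1) ×
    ((n ℕ.≤ num s 2 × (∀ e → e ∉ set s 1 → ¬ (0# ≤ w e))) ⊎ (num s 2 ℕ.< n × n ℕ.< m ℕ.+ ∣ set s 1 ∣))

  halts-greedyStep : ∀ {m s} → Iterating (suc m) s → test (2 <ᵗ 0) s ≡ true →
                     Halts greedyStep s ((3 ℕ.+ n ℕ.* 6) ℕ.+ 5) (Iterating m)
  halts-greedyStep {m} {s} (n≡ , gr , progress) t = halts-⨾ (halts-scan n≡) λ { (n≡′ , refl , cand) → act n≡′ cand }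
    where
    m<n : num s 2 ℕ.< n
    m<n = subst (num s 2 ℕ.<_) n≡ (does-true (num s 2 ℕ.<? num s 0) t)
    n<  : n ℕ.< suc m ℕ.+ ∣ set s 1 ∣
    n< = [ (λ (n≤m , _) → contradiction n≤m (ℕ.<⇒≱ m<n)) , proj₂ ]′ progress
    act : ∀ {ν} → ν 0 ≡ n → Candidate (set s 1) n (ν 2) →
          Halts (ifᵖ (2 <ᵗ 0) process skip) ⟨ ν , set s ⟩ 5 (Iterating m)
    act {ν} n≡′ (inj₁ (m≡n , none)) = halts-if
      (λ t → contradiction (does-true (ν 2 ℕ.<? ν 0) t) (ℕ.<-irrefl (trans m≡n (sym n≡′))))
      (λ _ → halts-skip (n≡′ , gr , inj₁ (ℕ.≤-reflexive (sym m≡n) , λ e → none e (toℕ<n e))))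
    act {ν} n≡′ (inj₂ (e , m≡e , e∉P , 0≤we , max)) = halts-if
      (λ _ → weaken (halts-process m≡e e∉P 0≤we (λ g → max g (toℕ<n g)) gr))
      (λ t → contradiction e<n (does-false (ν 2 ℕ.<? ν 0) t))
      where
      e<n : ν 2 ℕ.< ν 0
      e<n rewrite m≡e | n≡′ = toℕ<n e
      weaken : ∀ {p b s₀} →
        Halts p s₀ b (λ s′ → num s′ ≡ ν × set s′ 1 ≡ set s 1 ∪ ⁅ e ⁆ × Greedy G M w (set s′ 0) (set s′ 1)) →
        Halts p s₀ b (Iterating m)
      weaken (t , s′ , run , t≤ , refl , P≡ , gr′) = t , s′ , run , t≤ , n≡′ , gr′ ,
        inj₂ (subst (ν 2 ℕ.<_) n≡′ e<n , subst (λ P → n ℕ.< m ℕ.+ ∣ P ∣) (sym P≡)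
          (ℕ.≤-trans n< (ℕ.≤-trans (ℕ.≤-reflexive (sym (ℕ.+-suc m _))) (ℕ.+-monoʳ-≤ m (∣p∣<∣insert∣ e∉P)))))

  halts-greedy : ∀ k → Halts greedy (initial n k) (10 ℕ.* suc n ℕ.^ 2) (OptimalAvoiding G M w ∅ ∘ output)
  halts-greedy k with halts-while Iterating stop halts-greedyStep (suc n) {initial n k}
                        (refl , greedy-start G M w , start)
    where
    stop : ∀ s → Iterating 0 s → test (2 <ᵗ 0) s ≡ false
    stop s (n≡ , _ , inj₁ (n≤ , _)) rewrite n≡ = dec-false (num s 2 ℕ.<? n) (ℕ.≤⇒≯ n≤)
    stop s (_ , _ , inj₂ (_ , n<)) = contradiction (∣p∣≤n (set s 1)) (ℕ.<⇒≱ n<)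
    -- The initial 0 in register 2 is no candidate; it only lets the loop start. If `n` is 0 the
    -- loop is never entered, and no element is left to process.
    start : (n ℕ.≤ 0 × (∀ e → e ∉ ∅ → ¬ (0# ≤ w e))) ⊎ (0 ℕ.< n × n ℕ.< suc n ℕ.+ ∣ ∅ {n} ∣)
    start with 0 ℕ.<? n
    ... | yes 0<n = inj₂ (0<n , ℕ.s≤s (ℕ.m≤m+n n _))
    ... | no  0≮n = inj₁ (ℕ.≮⇒≥ 0≮n , λ e → contradiction (ℕ.≤-<-trans ℕ.z≤n (toℕ<n e)) 0≮n)
  ... | t , s , run , t≤ , (m , n≡ , gr , inj₁ (_ , done)) , _ =
    t , s , run , ℕ.≤-trans t≤ bound , greedy-end G M w gr done
    where
    bound : suc (suc n ℕ.* suc ((3 ℕ.+ n ℕ.* 6) ℕ.+ 5)) ℕ.≤ 10 ℕ.* suc n ℕ.^ 2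
    bound = ℕ.m+n≤o⇒m≤o _ (ℕ.≤-reflexive (running-time n))
  ... | t , s , run , t≤ , (m , n≡ , gr , inj₂ (m<n , _)) , stopped =
    contradiction (subst (num s 2 ℕ.<_) (sym n≡) m<n) (does-false (num s 2 ℕ.<? num s 0) stopped)

theorem1 : ∀ {c ℓ₁ ℓ₂} (G : OrderedAbelianGroup c ℓ₁ ℓ₂) →
    let open OrderedAbelianGroup G in
    (∀ {n} (M : Matroid n) (w : Fin n → Carrier) (k : ℕ) → 1 ℕ.≤ k →
      -- Needed: on a single non-loop of weight -1 the basis has value -1, the empty set 0.
      (∀ e → 0# ≤ w e) →
      (B : Subset n) → IsMaxWeightBasis G w M B →
      Robust.IsOptimalFirstStage G w M k B)
    × RobustMatroidBasisInPolynomialTime G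
theorem1 G =
  (λ M w k _ 0≤w B maxB → optimal-first-stage G M w k (maxWeightBasis-optimal G M w 0≤w maxB)) ,
  -- Weights may be negative here, so optimality comes from the greedy invariant instead of
  -- `maxWeightBasis-optimal`.
  greedy , 10 , 2 , λ M w k _ →
    let t , s , run , t≤ , opt = halts-greedy G M w k
    in t , s , run , t≤ , optimal-first-stage G M w k opt
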